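{- A graph $G$ satisfies $\gamma_{r2}(H)=\gamma_R(H)$ for every induced subgraph $H$ of $G$ if and only if $G$ is $\{P_5,C_5,C_4\}$-free.
   Context: All graphs are finite, simple and undirected. A $2$-rainbow dominating function of a graph $G$ is a function $f:V(G)\to 2^{\{1,2\}}$ such that $\bigcup_{v\in N_G(u)} f(v)=\{1,2\}$ for every vertex $u$ with $f(u)=\emptyset$; its weight is $\sum_{u\in V(G)}|f(u)|$, and $\gamma_{r2}(G)$ is the minimum weight of a $2$-rainbow dominating function of $G$. A Roman dominating function of $G$ is a function $g:V(G)\to\{0,1,2\}$ such that every vertex $u$ with $g(u)=0$ has a neighbor $v$ with $g(v)=2$; its weight is $\sum_{u\in V(G)} g(u)$, and $\gamma_R(G)$ is the minimum weight of a Roman dominating function of $G$. $P_5$ is the path on $5$ vertices, $C_n$ the cycle on $n$ vertices; $G$ is $\{P_5,C_5,C_4\}$-free if it has no induced subgraph isomorphic to $P_5$, $C_5$ or $C_4$. -}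

module Defs where

open import Data.Nat using (ℕ; zero; suc; _+_; _≤_; _≡ᵇ_)
open import Data.Fin using (Fin; toℕ)
open import Data.Bool using (Bool; true; false; _∨_; _∧_; if_then_else_)
open import Data.List using (List; map; allFin)
open import Data.Nat.ListAction using (sum)
open import Data.Empty using (⊥)
open import Data.Product using (Σ; _×_; _,_; proj₁; proj₂; ∃)
open import Relation.Binary.PropositionalEquality using (_≡_)
open import Function.Definitions using (Injective)

Adj : ℕ → Set
Adj n = Fin n → Fin n → Bool

record Graph (n : ℕ) : Set where
  field
    adj     : Adj n
    adj-sym : ∀ u v → adj u v ≡ adj v u
    irrefl  : ∀ u → adj u u ≡ false
open Graph public

Σv : ∀ {n} → (Fin n → ℕ) → ℕ
Σv {n} w = sum (map w (allFin n))

-- A subset of {1,2} is a pair of Booleans (membership of 1, membership of 2).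
Sub12 : Set
Sub12 = Bool × Bool

card : Sub12 → ℕ
card (a , b) = (if a then 1 else 0) + (if b then 1 else 0)

Is2RDF : ∀ {n} → Adj n → (Fin n → Sub12) → Set
Is2RDF {n} E f = ∀ u → f u ≡ (false , false) →
  (∃ λ v → E u v ≡ true × proj₁ (f v) ≡ true) ×
  (∃ λ v → E u v ≡ true × proj₂ (f v) ≡ true)

weight2R : ∀ {n} → (Fin n → Sub12) → ℕ
weight2R f = Σv (λ u → card (f u))

Isγr2 : ∀ {n} → Adj n → ℕ → Set
Isγr2 E k =
  (∃ λ f → Is2RDF E f × weight2R f ≡ k) ×
  (∀ f → Is2RDF E f → k ≤ weight2R f)

IsRDF : ∀ {n} → Adj n → (Fin n → Fin 3) → Set
IsRDF E g = ∀ u → toℕ (g u) ≡ 0 → ∃ λ v → E u v ≡ true × toℕ (g v) ≡ 2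

weightR : ∀ {n} → (Fin n → Fin 3) → ℕ
weightR g = Σv (λ u → toℕ (g u))

IsγR : ∀ {n} → Adj n → ℕ → Set
IsγR E k =
  (∃ λ g → IsRDF E g × weightR g ≡ k) ×
  (∀ g → IsRDF E g → k ≤ weightR g)

-- The induced subgraph of G on the image of an injective map ι : Fin m → Fin n
-- (every induced subgraph of G is, up to isomorphism, of this form).
induced : ∀ {m n} → Graph n → (Fin m → Fin n) → Adj m
induced G ι i j = adj G (ι i) (ι j)

ContainsInduced : ∀ {k n} → Adj k → Graph n → Set
ContainsInduced {k} {n} F G =
  Σ (Fin k → Fin n) λ φ → Injective _≡_ _≡_ φ × (∀ i j → F i j ≡ adj G (φ i) (φ j))

pathAdj : ∀ k → Adj k
pathAdj k i j = (suc (toℕ i) ≡ᵇ toℕ j) ∨ (suc (toℕ j) ≡ᵇ toℕ i)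

cycleAdj : ∀ k → Adj k
cycleAdj k i j = pathAdj k i j
  ∨ ((toℕ i ≡ᵇ 0) ∧ (suc (toℕ j) ≡ᵇ k))
  ∨ ((toℕ j ≡ᵇ 0) ∧ (suc (toℕ i) ≡ᵇ k))

P5 : Adj 5
P5 = pathAdj 5

C5 : Adj 5
C5 = cycleAdj 5

C4 : Adj 4
C4 = cycleAdj 4

P5C5C4-free : ∀ {n} → Graph n → Set
P5C5C4-free G =
  (ContainsInduced P5 G → ⊥) × (ContainsInduced C5 G → ⊥) × (ContainsInduced C4 G → ⊥)

AllInducedEqual : ∀ {n} → Graph n → Set
AllInducedEqual {n} G =
  ∀ (m : ℕ) (ι : Fin m → Fin n) → Injective _≡_ _≡_ ι →
  ∀ a b → Isγr2 (induced G ι) a → IsγR (induced G ι) b → a ≡ b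

{-# OPTIONS --safe #-}
module Submission where

-- A Roman dominating function becomes a 2-rainbow dominating function of the same
-- weight via 1 ↦ {1}, 2 ↦ {1,2}.  Conversely, let f be a 2-rainbow dominating function
-- of a {P₅,C₅,C₄}-free graph, S the set of vertices with |f(v)| = 1, and call u deficient
-- if f(u) = ∅ and u has no neighbour coloured {1,2}; without deficient vertices v ↦ |f(v)|
-- is a Roman dominating function.  Otherwise S shrinks without increasing the weight by
-- recolouring a set D with {1,2} and X ∖ D with ∅, where ∅ ≠ X ⊆ S, 2|D| ≤ |X|, and
-- D dominates X ∖ D and all deficient vertices with a neighbour in X:
--  * if x, y ∈ S are adjacent and every deficient neighbour of x is one of y,
--    take X = {x,y} and D = {y};
--  * if some x ∈ S has a neighbour in S but no pair is nested in this way, then adjacency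
--    is transitive on S; take X = S ∩ N[x], a clique, and for D its smaller colour class;
--  * if S is independent, take X = S ∩ N(u) and D = {u} for any deficient u.

open import Defs
open import Data.Bool using (Bool; true; false; _xor_; if_then_else_)
import Data.Bool.Properties as Bool
open import Data.Empty using (⊥; ⊥-elim)
open import Data.Fin using (Fin; zero; suc; toℕ; _<_)
open import Data.Fin.Patterns using (0F; 1F; 2F; 3F)
open import Data.Fin.Properties using (any?; all?; <-cmp) renaming (_≟_ to _≟ᶠ_)
open import Data.List.Base using (tabulate; allFin)
open import Data.List.Properties using (map-tabulate; map-cong)
open import Data.Nat using (ℕ; zero; suc; _+_; _≤_; z≤n; s≤s; _≤?_) renaming (_<_ to _<ⁿ_)
open import Data.Nat.Induction using (<-wellFounded)
open import Data.Nat.ListAction using (sum)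
open import Data.Nat.Properties
  using (≤-refl; ≤-reflexive; ≤-trans; ≤-antisym; ≤-total; +-mono-≤; +-monoʳ-≤; +-monoˡ-≤;
         +-cancelʳ-≤; +-comm; m≤n+m; +-0-commutativeMonoid; module ≤-Reasoning)
  renaming (_≟_ to _≟ⁿ_)
open import Data.Product using (∃; _×_; _,_; proj₁; proj₂)
open import Data.Product.Properties using (≡-dec)
open import Data.Sum using (_⊎_; inj₁; inj₂)
open import Data.Unit using (⊤; tt)
open import Data.Vec using (Vec; []; _∷_; lookup) renaming (tabulate to tabulateᵛ)
open import Data.Vec.Properties using (lookup∘tabulate)
import Data.Vec.Functional as F
open import Function using (_∘_; id; case_of_)
open import Function.Bundles using (_⇔_; mk⇔)
open import Function.Definitions using (Injective)
open import Induction.WellFounded using (Acc; acc)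
open import Relation.Binary using (tri<; tri≈; tri>; DecidableEquality)
open import Relation.Binary.PropositionalEquality
open import Relation.Nullary using (¬_; Dec; yes; no; does; contradiction)
open import Relation.Nullary.Decidable
  using (_×-dec_; _⊎-dec_; _→-dec_; ¬?; map′; from-yes; decidable-stable)
open import Relation.Unary using (Decidable)

open import Algebra.Properties.CommutativeMonoid.Sum +-0-commutativeMonoid
  using (∑-distrib-+; sum-replicate-zero) renaming (sum to ∑)

-- Sums and cardinalities

Σv≡∑ : ∀ {n} (w : Fin n → ℕ) → Σv w ≡ ∑ w
Σv≡∑ w = trans (cong sum (map-tabulate id w)) (sum-tabulate w)
  where
  sum-tabulate : ∀ {n} (w : Fin n → ℕ) → sum (tabulate w) ≡ ∑ w
  sum-tabulate {zero}  w = refl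
  sum-tabulate {suc n} w = cong (w zero +_) (sum-tabulate (w ∘ suc))

Σv-cong : ∀ {n} {v w : Fin n → ℕ} → v ≗ w → Σv v ≡ Σv w
Σv-cong {n} v≗w = cong sum (map-cong v≗w (allFin n))

Σv-+ : ∀ {n} (v w : Fin n → ℕ) → Σv (λ i → v i + w i) ≡ Σv v + Σv w
Σv-+ v w = trans (Σv≡∑ (λ i → v i + w i))
  (trans (∑-distrib-+ v w) (sym (cong₂ _+_ (Σv≡∑ v) (Σv≡∑ w))))

Σv-mono : ∀ {n} (v w : Fin n → ℕ) → (∀ i → v i ≤ w i) → Σv v ≤ Σv w
Σv-mono v w v≤w = subst₂ _≤_ (sym (Σv≡∑ v)) (sym (Σv≡∑ w)) (∑-mono v w v≤w)
  where
  ∑-mono : ∀ {n} (v w : Fin n → ℕ) → (∀ i → v i ≤ w i) → ∑ v ≤ ∑ w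
  ∑-mono {zero}  v w v≤w = z≤n
  ∑-mono {suc n} v w v≤w = +-mono-≤ (v≤w zero) (∑-mono (v ∘ suc) (w ∘ suc) (v≤w ∘ suc))

indicator : ∀ {A : Set} → Dec A → ℕ
indicator a? = if does a? then 1 else 0

# : ∀ {n} {P : Fin n → Set} → Decidable P → ℕ
# P? = Σv (λ v → indicator (P? v))

#-singleton : ∀ {n} (x : Fin n) → # (x ≟ᶠ_) ≡ 1
#-singleton x = trans (Σv≡∑ (λ v → indicator (x ≟ᶠ v))) (∑-indicator x)
  where
  ∑-indicator : ∀ {n} (x : Fin n) → ∑ (λ v → indicator (x ≟ᶠ v)) ≡ 1
  ∑-indicator {suc n} zero    = cong suc (sum-replicate-zero n)
  ∑-indicator {suc n} (suc x) = ∑-indicator x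

#-disjoint-≤ : ∀ {n} {P Q R : Fin n → Set} (P? : Decidable P) (Q? : Decidable Q) (R? : Decidable R) →
  (∀ v → P v → R v) → (∀ v → Q v → R v) → (∀ v → P v → ¬ Q v) → # P? + # Q? ≤ # R?
#-disjoint-≤ P? Q? R? P⊆R Q⊆R disjoint =
  subst (_≤ # R?) (Σv-+ (λ v → indicator (P? v)) (λ v → indicator (Q? v))) (Σv-mono _ _ pointwise)
  where
  pointwise : ∀ v → indicator (P? v) + indicator (Q? v) ≤ indicator (R? v)
  pointwise v with P? v | Q? v | R? v
  ... | yes p | yes q | _     = contradiction q (disjoint v p)
  ... | yes p | no _  | yes _ = ≤-refl
  ... | yes p | no _  | no ¬r = contradiction (P⊆R v p) ¬r
  ... | no _  | yes q | yes _ = ≤-refl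
  ... | no _  | yes q | no ¬r = contradiction (Q⊆R v q) ¬r
  ... | no _  | no _  | _     = z≤n

#≥2 : ∀ {n} {P : Fin n → Set} (P? : Decidable P) {x y : Fin n} → P x → P y → x ≢ y → 2 ≤ # P?
#≥2 {P = P} P? {x} {y} px py x≢y =
  subst (_≤ # P?) (cong₂ _+_ (#-singleton x) (#-singleton y))
    (#-disjoint-≤ (x ≟ᶠ_) (y ≟ᶠ_) P?
      (λ { v refl → px }) (λ { v refl → py }) (λ { v refl y≡x → x≢y (sym y≡x) }))

-- Forbidden induced subgraphs

-- A nested tuple of rows: for a concrete `k` the pairs `i < j` are supplied by one pattern-matching
-- function per row, and symmetry and irreflexivity settle the rest.
Upper : ∀ {k} → (Fin k → Fin k → Set) → Set
Upper {zero}  R = ⊤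
Upper {suc k} R = (∀ j → R zero (suc j)) × Upper (λ i j → R (suc i) (suc j))

upper⇒< : ∀ {k} (R : Fin k → Fin k → Set) → Upper R → ∀ i j → i < j → R i j
upper⇒< R (row , rest) zero    (suc j) _         = row j
upper⇒< R (row , rest) (suc i) (suc j) (s≤s i<j) = upper⇒< _ rest i j i<j

Symmetric : ∀ {k} → Adj k → Set
Symmetric F = ∀ i j → F i j ≡ F j i

Irreflexive : ∀ {k} → Adj k → Set
Irreflexive F = ∀ i → F i i ≡ false

-- True of `P5` and `C5`, where a map that matches adjacency is therefore automatically injective.
-- Opposite vertices of `C4` are twins, hence the explicit `a ≢ c` and `b ≢ d` in `no-C4`.
TwinFree : ∀ {k} → Adj k → Set
TwinFree F = ∀ i j → (∀ k → F i k ≡ F j k) → i ≡ j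

symmetric? : ∀ {k} (F : Adj k) → Dec (Symmetric F)
symmetric? F = all? λ i → all? λ j → F i j Bool.≟ F j i

irreflexive? : ∀ {k} (F : Adj k) → Dec (Irreflexive F)
irreflexive? F = all? λ i → F i i Bool.≟ false

twinFree? : ∀ {k} (F : Adj k) → Dec (TwinFree F)
twinFree? F = all? λ i → all? λ j → (all? λ k → F i k Bool.≟ F j k) →-dec (i ≟ᶠ j)

module _ {n} (G : Graph n) where

  upper⇒match : ∀ {k} (F : Adj k) → Symmetric F → Irreflexive F → (φ : Fin k → Fin n) →
    Upper (λ i j → F i j ≡ adj G (φ i) (φ j)) → ∀ i j → F i j ≡ adj G (φ i) (φ j)
  upper⇒match F F-sym F-irr φ up i j with <-cmp i j
  ... | tri< i<j _ _  = upper⇒< _ up i j i<j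
  ... | tri≈ _ refl _ = trans (F-irr i) (sym (irrefl G (φ i)))
  ... | tri> _ _ j<i  = trans (F-sym i j) (trans (upper⇒< _ up j i j<i) (adj-sym G (φ j) (φ i)))

  upper⇒injective : ∀ {k} (φ : Fin k → Fin n) → Upper (λ i j → φ i ≢ φ j) → Injective _≡_ _≡_ φ
  upper⇒injective φ up {i} {j} φi≡φj with <-cmp i j
  ... | tri< i<j _ _ = contradiction φi≡φj (upper⇒< _ up i j i<j)
  ... | tri≈ _ i≡j _ = i≡j
  ... | tri> _ _ j<i = contradiction (sym φi≡φj) (upper⇒< _ up j i j<i)

  twinFree-embedding : ∀ {k} (F : Adj k) → Symmetric F → Irreflexive F → TwinFree F →
    (φ : Fin k → Fin n) → Upper (λ i j → F i j ≡ adj G (φ i) (φ j)) → ContainsInduced F G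
  twinFree-embedding F F-sym F-irr F-twinFree φ up = φ , injective , match
    where
    match = upper⇒match F F-sym F-irr φ up
    injective : Injective _≡_ _≡_ φ
    injective {i} {j} φi≡φj = F-twinFree i j λ k →
      trans (match i k) (trans (cong (λ v → adj G v (φ k)) φi≡φj) (sym (match j k)))

inducedGraph : ∀ {m n} → Graph n → (Fin m → Fin n) → Graph m
inducedGraph G ι = record
  { adj     = induced G ι
  ; adj-sym = λ u v → adj-sym G (ι u) (ι v)
  ; irrefl  = λ u → irrefl G (ι u)
  }

induced-free : ∀ {m n} (G : Graph n) (ι : Fin m → Fin n) → Injective _≡_ _≡_ ι →
  P5C5C4-free G → P5C5C4-free (inducedGraph G ι)
induced-free G ι ι-inj (noP5 , noC5 , noC4) = noP5 ∘ lift , noC5 ∘ lift , noC4 ∘ lift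
  where
  lift : ∀ {k} {F : Adj k} → ContainsInduced F (inducedGraph G ι) → ContainsInduced F G
  lift (φ , φ-inj , match) = ι ∘ φ , φ-inj ∘ ι-inj , match

-- Colour sets of size one

_≟ˢ_ : DecidableEquality Sub12
_≟ˢ_ = ≡-dec Bool._≟_ Bool._≟_

single : Sub12 → Bool
single (a , b) = a xor b

singles : ∀ {n} → (Fin n → Sub12) → ℕ
singles f = Σv (λ v → if single (f v) then 1 else 0)

card-single : ∀ s → single s ≡ true → card s ≡ 1
card-single (true  , false) _ = refl
card-single (false , true)  _ = refl

-- Adjacency in graphs without induced P₅, C₅ and C₄

module Free {n} (G : Graph n) (free : P5C5C4-free G) where

  infix 4 _∼_ _≁_ _∼?_

  _∼_ _≁_ : Fin n → Fin n → Set
  u ∼ v = adj G u v ≡ true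
  u ≁ v = adj G u v ≡ false

  _∼?_ : ∀ u v → Dec (u ∼ v)
  u ∼? v = adj G u v Bool.≟ true

  ∼-or-≁ : ∀ u v → u ∼ v ⊎ u ≁ v
  ∼-or-≁ u v with adj G u v
  ... | true  = inj₁ refl
  ... | false = inj₂ refl

  ∼-sym : ∀ {u v} → u ∼ v → v ∼ u
  ∼-sym {u} {v} = trans (adj-sym G v u)

  ≁-sym : ∀ {u v} → u ≁ v → v ≁ u
  ≁-sym {u} {v} = trans (adj-sym G v u)

  ≁⇒¬∼ : ∀ {u v} → u ≁ v → ¬ u ∼ v
  ≁⇒¬∼ u≁v u∼v = case trans (sym u∼v) u≁v of λ ()

  ∼⇒≢ : ∀ {u v} → u ∼ v → u ≢ v
  ∼⇒≢ {u} u∼u refl = ≁⇒¬∼ (irrefl G u) u∼u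

  no-C4 : ∀ {a b c d} → a ∼ b → b ∼ c → c ∼ d → d ∼ a →
    a ≁ c → b ≁ d → a ≢ c → b ≢ d → ⊥
  no-C4 {a} {b} {c} {d} ab bc cd da ac bd a≢c b≢d = proj₂ (proj₂ free)
    ( φ
    , upper⇒injective G φ
        ( (λ { 0F → ∼⇒≢ ab ; 1F → a≢c ; 2F → ∼⇒≢ (∼-sym da) })
        , (λ { 0F → ∼⇒≢ bc ; 1F → b≢d }) , (λ { 0F → ∼⇒≢ cd }) , (λ ()) , tt)
    , upper⇒match G C4 (from-yes (symmetric? C4)) (from-yes (irreflexive? C4)) φ
        ( (λ { 0F → sym ab ; 1F → sym ac ; 2F → sym (∼-sym da) })
        , (λ { 0F → sym bc ; 1F → sym bd }) , (λ { 0F → sym cd }) , (λ ()) , tt))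
    where
    φ : Fin 4 → Fin n
    φ = a F.∷ b F.∷ c F.∷ d F.∷ F.[]

  -- An edge between the ends would make it an induced C₅ instead of an induced P₅.
  no-path : ∀ {a b c d e} → a ∼ b → b ∼ c → c ∼ d → d ∼ e →
    a ≁ c → a ≁ d → b ≁ d → b ≁ e → c ≁ e → ⊥
  no-path {a} {b} {c} {d} {e} ab bc cd de ac ad bd be ce with ∼-or-≁ a e
  ... | inj₁ ae = proj₁ (proj₂ free)
    (twinFree-embedding G C5 (from-yes (symmetric? C5)) (from-yes (irreflexive? C5))
      (from-yes (twinFree? C5)) (a F.∷ b F.∷ c F.∷ d F.∷ e F.∷ F.[])
      ( (λ { 0F → sym ab ; 1F → sym ac ; 2F → sym ad ; 3F → sym ae })
      , (λ { 0F → sym bc ; 1F → sym bd ; 2F → sym be })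
      , (λ { 0F → sym cd ; 1F → sym ce }) , (λ { 0F → sym de }) , (λ ()) , tt))
  ... | inj₂ ae = proj₁ free
    (twinFree-embedding G P5 (from-yes (symmetric? P5)) (from-yes (irreflexive? P5))
      (from-yes (twinFree? P5)) (a F.∷ b F.∷ c F.∷ d F.∷ e F.∷ F.[])
      ( (λ { 0F → sym ab ; 1F → sym ac ; 2F → sym ad ; 3F → sym ae })
      , (λ { 0F → sym bc ; 1F → sym bd ; 2F → sym be })
      , (λ { 0F → sym cd ; 1F → sym ce }) , (λ { 0F → sym de }) , (λ ()) , tt))

  -- If `w` were neither `x` nor adjacent to it, `w u x y v` would contradict `no-path`, unless
  -- `u ∼ v` or `w ∼ y`; these edges close the induced 4-cycles `u x y v` and `w u x y`.
  private-neighbour : ∀ {x y u v w} → x ∼ y → u ∼ x → u ≁ y → v ∼ y → v ≁ x →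
    u ≢ y → v ≢ x → u ∼ w → x ≡ w ⊎ x ∼ w
  private-neighbour {x} {y} {u} {v} {w} xy ux uy vy vx u≢y v≢x uw with x ≟ᶠ w | ∼-or-≁ x w
  ... | yes x≡w | _       = inj₁ x≡w
  ... | no _    | inj₁ xw = inj₂ xw
  ... | no x≢w  | inj₂ xw with ∼-or-≁ u v
  ...   | inj₁ uv = ⊥-elim (no-C4 ux xy (∼-sym vy) (∼-sym uv) uy (≁-sym vx) u≢y (v≢x ∘ sym))
  ...   | inj₂ uv with ∼-or-≁ w y
  ...     | inj₁ wy = ⊥-elim (no-C4 (∼-sym uw) ux xy (∼-sym wy) (≁-sym xw) uy (x≢w ∘ sym) u≢y)
  ...     | inj₂ wy = ⊥-elim (no-path (∼-sym uw) ux xy (∼-sym vy) (≁-sym xw) wy uy uv (≁-sym vx))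

  -- Without the edge `s r`, the path `w s t r w′` contradicts `no-path`, and each of the possible
  -- chords `w r` and `w′ s` closes an induced C₄ through `t`.
  middle-private⇒∼ : ∀ {s t r w w′} → s ∼ t → t ∼ r → s ≢ r →
    w ∼ s → w ≁ t → w ≢ t → w′ ∼ r → w′ ≁ t → w′ ≢ t → s ∼ r
  middle-private⇒∼ {s} {t} {r} {w} {w′} st tr s≢r ws wt w≢t w′r w′t w′≢t with ∼-or-≁ s r
  ... | inj₁ sr = sr
  ... | inj₂ sr with ∼-or-≁ w r | ∼-or-≁ w′ s
  ...   | inj₁ wr | _        = ⊥-elim (no-C4 ws st tr (∼-sym wr) wt sr w≢t s≢r)
  ...   | inj₂ _  | inj₁ w′s = ⊥-elim (no-C4 w′r (∼-sym tr) (∼-sym st) (∼-sym w′s) w′t (≁-sym sr) w′≢t (s≢r ∘ sym))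
  ...   | inj₂ wr | inj₂ w′s =
    ⊥-elim (no-path ws st tr (∼-sym w′r) wt wr sr (≁-sym w′s) (≁-sym w′t))

  -- Without the edge `u u′`, the path `y u x u′ y′` contradicts `no-path`, and each of the possible
  -- chords `y u′` and `u y′` closes an induced C₄ through `x`.
  common-neighbour⇒∼ : ∀ {u u′ x y y′} → u ≢ u′ → u ∼ x → u′ ∼ x → u ∼ y → u′ ∼ y′ →
    x ≢ y → x ≢ y′ → x ≁ y → x ≁ y′ → u ∼ u′
  common-neighbour⇒∼ {u} {u′} {x} {y} {y′} u≢u′ ux u′x uy u′y′ x≢y x≢y′ xy xy′ with ∼-or-≁ u u′
  ... | inj₁ uu′ = uu′
  ... | inj₂ uu′ with ∼-or-≁ y u′ | ∼-or-≁ u y′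
  ...   | inj₁ yu′ | _        = ⊥-elim (no-C4 ux (∼-sym u′x) (∼-sym yu′) (∼-sym uy) uu′ xy u≢u′ x≢y)
  ...   | inj₂ _   | inj₁ uy′ = ⊥-elim (no-C4 ux (∼-sym u′x) u′y′ (∼-sym uy′) uu′ xy′ u≢u′ x≢y′)
  ...   | inj₂ yu′ | inj₂ uy′ =
    ⊥-elim (no-path (∼-sym uy) ux (∼-sym u′x) u′y′ (≁-sym xy) yu′ uu′ uy′ xy′)

  -- Recolouring a 2-rainbow dominating function

  module Recolour (f : Fin n → Sub12) (f-dom : Is2RDF (adj G) f) where

    Single : Fin n → Set
    Single v = single (f v) ≡ true

    Single? : Decidable Single
    Single? v = single (f v) Bool.≟ true

    -- The vertices that the Roman dominating function read off from f leaves undominated.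
    Deficient : Fin n → Set
    Deficient u = f u ≡ (false , false) × ¬ ∃ λ c → u ∼ c × f c ≡ (true , true)

    fullNeighbour? : ∀ u → Dec (∃ λ c → u ∼ c × f c ≡ (true , true))
    fullNeighbour? u = any? λ c → (u ∼? c) ×-dec (f c ≟ˢ (true , true))

    Deficient? : Decidable Deficient
    Deficient? u = (f u ≟ˢ (false , false)) ×-dec ¬? (fullNeighbour? u)

    deficient≢single : ∀ {u v} → Deficient u → Single v → u ≢ v
    deficient≢single (fu , _) sv refl = case trans (sym (cong single fu)) sv of λ ()

    -- Some neighbour contributes the element 1, and it cannot be coloured {1,2} since `u` is
    -- deficient.
    neighbour₁ : ∀ {u} → Deficient u → ∃ λ v → u ∼ v × f v ≡ (true , false)
    neighbour₁ {u} (fu , no-full) with proj₁ (f-dom u fu)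
    ... | v , uv , 1∈fv with f v in fv
    ...   | true , true  = contradiction (v , uv , fv) no-full
    ...   | true , false = v , uv , fv

    neighbour₂ : ∀ {u} → Deficient u → ∃ λ v → u ∼ v × f v ≡ (false , true)
    neighbour₂ {u} (fu , no-full) with proj₂ (f-dom u fu)
    ... | v , uv , 2∈fv with f v in fv
    ...   | true  , true = contradiction (v , uv , fv) no-full
    ...   | false , true = v , uv , fv

    -- The neighbours coloured {1} and {2} are distinct, so at least one of them is not `x`.
    another-neighbour : ∀ {u} → Deficient u → ∀ x → ∃ λ y → u ∼ y × Single y × x ≢ y
    another-neighbour du x with neighbour₁ du | neighbour₂ du
    ... | a , ua , fa | b , ub , fb with x ≟ᶠ a
    ...   | no x≢a   = a , ua , cong single fa , x≢a
    ...   | yes refl = b , ub , cong single fb , λ { refl → case trans (sym fa) fb of λ () }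

    -- The strict drop in `singles` makes the recursion in `2RDF⇒RDF` terminate.
    Improvement : Set
    Improvement = ∃ λ f′ → Is2RDF (adj G) f′ × weight2R f′ ≤ weight2R f × singles f′ <ⁿ singles f

    -- Emptying `X` saves `# X?`, and filling `D` then costs at most twice `# D?`, so `2D≤X` bounds
    -- the weight; `∃X` gives the strict drop in `singles`.
    module Exchange {D X : Fin n → Set} (D? : Decidable D) (X? : Decidable X)
      (X⊆S : ∀ v → X v → Single v)
      (X-dom : ∀ v → X v → ¬ D v → ∃ λ d → v ∼ d × D d)
      (deficient-dom : ∀ u x → Deficient u → ¬ D u → u ∼ x → X x → ∃ λ d → u ∼ d × D d)
      (2D≤X : # D? + # D? ≤ # X?)
      (∃X : ∃ X)
      where

      recolour : Fin n → Sub12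
      recolour v = if does (D? v) then (true , true) else
                   if does (X? v) then (false , false) else f v

      recolour-D : ∀ v → D v → recolour v ≡ (true , true)
      recolour-D v dv with D? v
      ... | yes _  = refl
      ... | no ¬dv = contradiction dv ¬dv

      recolour-keeps : ∀ v → ¬ X v → recolour v ≡ (true , true) ⊎ recolour v ≡ f v
      recolour-keeps v ¬xv with D? v | X? v
      ... | yes _ | _      = inj₁ refl
      ... | no _  | yes xv = contradiction xv ¬xv
      ... | no _  | no _   = inj₂ refl

      Dominated : Fin n → Set
      Dominated u =
        (∃ λ v → u ∼ v × proj₁ (recolour v) ≡ true) ×
        (∃ λ v → u ∼ v × proj₂ (recolour v) ≡ true)

      full-dominates : ∀ u v → u ∼ v → recolour v ≡ (true , true) → Dominated u
      full-dominates u v uv eq = (v , uv , cong proj₁ eq) , (v , uv , cong proj₂ eq)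

      D-dominates : ∀ u → (∃ λ d → u ∼ d × D d) → Dominated u
      D-dominates u (d , ud , dd) = full-dominates u d ud (recolour-D d dd)

      keeps₁ : ∀ v → ¬ X v → proj₁ (f v) ≡ true → proj₁ (recolour v) ≡ true
      keeps₁ v ¬xv 1∈fv with recolour-keeps v ¬xv
      ... | inj₁ eq = cong proj₁ eq
      ... | inj₂ eq = trans (cong proj₁ eq) 1∈fv

      keeps₂ : ∀ v → ¬ X v → proj₂ (f v) ≡ true → proj₂ (recolour v) ≡ true
      keeps₂ v ¬xv 2∈fv with recolour-keeps v ¬xv
      ... | inj₁ eq = cong proj₂ eq
      ... | inj₂ eq = trans (cong proj₂ eq) 2∈fv

      -- A neighbour coloured {1,2} is never in `X` and stays full. Otherwise `u` is deficient:
      -- `deficient-dom` applies if it has a neighbour in `X`, and if not, none of its neighbours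
      -- loses a colour.
      empty-dominated : ∀ u → ¬ D u → f u ≡ (false , false) → Dominated u
      empty-dominated u ¬du fu with fullNeighbour? u
      ... | yes (c , uc , fc) = full-dominates u c uc (c-full (recolour-keeps c c∉X))
        where
        c∉X : ¬ X c
        c∉X xc = case trans (sym (cong single fc)) (X⊆S c xc) of λ ()
        c-full : recolour c ≡ (true , true) ⊎ recolour c ≡ f c → recolour c ≡ (true , true)
        c-full (inj₁ eq) = eq
        c-full (inj₂ eq) = trans eq fc
      ... | no no-full with any? (λ x → (u ∼? x) ×-dec X? x)
      ...   | yes (x , ux , xx) = D-dominates u (deficient-dom u x (fu , no-full) ¬du ux xx)
      ...   | no ¬ux with f-dom u fu
      ...     | (a , ua , 1∈fa) , (b , ub , 2∈fb) =
        (a , ua , keeps₁ a (λ xa → ¬ux (a , ua , xa)) 1∈fa) ,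
        (b , ub , keeps₂ b (λ xb → ¬ux (b , ub , xb)) 2∈fb)

      recolour-dom : Is2RDF (adj G) recolour
      recolour-dom u eq with D? u | X? u
      recolour-dom u () | yes _  | _
      recolour-dom u eq | no ¬du | yes xu = D-dominates u (X-dom u xu ¬du)
      recolour-dom u eq | no ¬du | no _   = empty-dominated u ¬du eq

      -- The saving on `X` is added on the left, which avoids subtraction in ℕ.
      card-recolour : ∀ v → card (recolour v) + indicator (X? v) ≤
                            card (f v) + (indicator (D? v) + indicator (D? v))
      card-recolour v with D? v | X? v
      ... | yes _ | yes xv rewrite card-single (f v) (X⊆S v xv) = ≤-refl
      ... | yes _ | no _   = m≤n+m 2 (card (f v))
      ... | no _  | yes xv rewrite card-single (f v) (X⊆S v xv) = ≤-refl
      ... | no _  | no _   = ≤-refl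

      weight-recolour : weight2R recolour ≤ weight2R f
      weight-recolour = +-cancelʳ-≤ (# X?) _ _ (begin
        weight2R recolour + # X?             ≡⟨ Σv-+ (card ∘ recolour) (λ v → indicator (X? v)) ⟨
        Σv (λ v → card (recolour v) + indicator (X? v))
          ≤⟨ Σv-mono _ _ card-recolour ⟩
        Σv (λ v → card (f v) + (indicator (D? v) + indicator (D? v)))
          ≡⟨ Σv-+ (card ∘ f) (λ v → indicator (D? v) + indicator (D? v)) ⟩
        weight2R f + Σv (λ v → indicator (D? v) + indicator (D? v))
          ≡⟨ cong (weight2R f +_) (Σv-+ (λ v → indicator (D? v)) (λ v → indicator (D? v))) ⟩
        weight2R f + (# D? + # D?)           ≤⟨ +-monoʳ-≤ (weight2R f) 2D≤X ⟩
        weight2R f + # X?                    ∎)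
        where open ≤-Reasoning

      -- Only the colours ∅ and {1,2} are newly assigned, so no singleton is created, and the chosen
      -- element of `X` ceases to be one.
      single-recolour : ∀ v → (if single (recolour v) then 1 else 0) + indicator (proj₁ ∃X ≟ᶠ v) ≤
                              (if single (f v) then 1 else 0)
      single-recolour v with D? v | X? v | proj₁ ∃X ≟ᶠ v
      ... | yes _ | _      | no _     = z≤n
      ... | yes _ | _      | yes refl rewrite X⊆S v (proj₂ ∃X) = ≤-refl
      ... | no _  | yes _  | no _     = z≤n
      ... | no _  | yes xv | yes _    rewrite X⊆S v xv = ≤-refl
      ... | no _  | no _   | no _     = ≤-reflexive (+-comm _ 0)
      ... | no _  | no ¬xv | yes refl = contradiction (proj₂ ∃X) ¬xv

      singles-recolour : singles recolour <ⁿ singles f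
      singles-recolour = begin-strict
        singles recolour               <⟨ ≤-reflexive (+-comm 1 (singles recolour)) ⟩
        singles recolour + 1           ≡⟨ cong (singles recolour +_) (#-singleton (proj₁ ∃X)) ⟨
        singles recolour + # (proj₁ ∃X ≟ᶠ_)
          ≡⟨ Σv-+ _ (λ v → indicator (proj₁ ∃X ≟ᶠ v)) ⟨
        Σv (λ v → (if single (recolour v) then 1 else 0) + indicator (proj₁ ∃X ≟ᶠ v))
          ≤⟨ Σv-mono _ _ single-recolour ⟩
        singles f                      ∎
        where open ≤-Reasoning

      improvement : Improvement
      improvement = recolour , recolour-dom , weight-recolour , singles-recolour

    -- The three recolouring cases

    PrivateNeighbour : Fin n → Fin n → Set
    PrivateNeighbour x y = ∃ λ u → Deficient u × u ∼ x × u ≁ y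

    PrivateNeighbour? : ∀ x y → Dec (PrivateNeighbour x y)
    PrivateNeighbour? x y = any? λ u → Deficient? u ×-dec (u ∼? x) ×-dec (adj G u y Bool.≟ false)

    improve-nested : ∀ {x y} → Single x → Single y → x ∼ y → ¬ PrivateNeighbour x y → Improvement
    improve-nested {x} {y} sx sy xy nested =
      Exchange.improvement (y ≟ᶠ_) X? X⊆S X-dom deficient-dom 2D≤X (x , inj₁ refl)
      where
      X : Fin n → Set
      X v = x ≡ v ⊎ y ≡ v
      X? : Decidable X
      X? v = (x ≟ᶠ v) ⊎-dec (y ≟ᶠ v)
      X⊆S : ∀ v → X v → Single v
      X⊆S v (inj₁ refl) = sx
      X⊆S v (inj₂ refl) = sy
      X-dom : ∀ v → X v → y ≢ v → ∃ λ d → v ∼ d × y ≡ d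
      X-dom v (inj₁ refl) _   = y , xy , refl
      X-dom v (inj₂ y≡v)  y≢v = contradiction y≡v y≢v
      deficient-dom : ∀ u v → Deficient u → y ≢ u → u ∼ v → X v → ∃ λ d → u ∼ d × y ≡ d
      deficient-dom u v du _ uy (inj₂ refl) = y , uy , refl
      deficient-dom u v du _ ux (inj₁ refl) with ∼-or-≁ u y
      ... | inj₁ uy = y , uy , refl
      ... | inj₂ uy = contradiction (u , du , ux , uy) nested
      2D≤X : # (y ≟ᶠ_) + # (y ≟ᶠ_) ≤ # X?
      2D≤X = subst (_≤ # X?) (sym (cong₂ _+_ (#-singleton y) (#-singleton y)))
        (#≥2 X? (inj₁ refl) (inj₂ refl) (∼⇒≢ xy))

    improve-independent : ∀ {u} → Deficient u → (∀ {x y} → Single x → Single y → x ≁ y) → Improvement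
    improve-independent {u} du indep =
      Exchange.improvement (u ≟ᶠ_) X? (λ _ → proj₂) X-dom deficient-dom 2D≤X (a , ua , sa)
      where
      X : Fin n → Set
      X v = u ∼ v × Single v
      X? : Decidable X
      X? v = (u ∼? v) ×-dec Single? v
      a = proj₁ (neighbour₁ du)
      ua = proj₁ (proj₂ (neighbour₁ du))
      sa = cong single (proj₂ (proj₂ (neighbour₁ du)))
      X-dom : ∀ v → X v → u ≢ v → ∃ λ d → v ∼ d × u ≡ d
      X-dom v (uv , _) _ = u , ∼-sym uv , refl
      deficient-dom : ∀ u′ x → Deficient u′ → u ≢ u′ → u′ ∼ x → X x → ∃ λ d → u′ ∼ d × u ≡ d
      -- Second neighbours `y` of `u` and `y′` of `u′` are singletons, hence nonadjacent to `x` by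
      -- independence; they are the ends of the path that forces `u ∼ u′`.
      deficient-dom u′ x du′ u≢u′ u′x (ux , sx)
        with another-neighbour du x | another-neighbour du′ x
      ... | y , uy , sy , x≢y | y′ , u′y′ , sy′ , x≢y′ =
        u , ∼-sym (common-neighbour⇒∼ u≢u′ ux u′x uy u′y′ x≢y x≢y′ (indep sx sy) (indep sx sy′)) , refl
      2D≤X : # (u ≟ᶠ_) + # (u ≟ᶠ_) ≤ # X?
      2D≤X with another-neighbour du a
      ... | b , ub , sb , a≢b = subst (_≤ # X?) (sym (cong₂ _+_ (#-singleton u) (#-singleton u)))
        (#≥2 X? (ua , sa) (ub , sb) a≢b)

    -- `priv` also applies to the reversed edge: each end of an edge between singletons has a
    -- deficient neighbour that misses the other end.
    module Clique (priv : ∀ {x y} → Single x → Single y → x ∼ y → PrivateNeighbour x y)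
      {x y} (sx : Single x) (sy : Single y) (xy : x ∼ y) where

      ∼-trans-single : ∀ {s t r} → Single s → Single t → Single r → s ∼ t → t ∼ r → s ≢ r → s ∼ r
      ∼-trans-single ss st sr s∼t t∼r s≢r with priv ss st s∼t | priv sr st (∼-sym t∼r)
      ... | w , dw , ws , wt | w′ , dw′ , w′r , w′t =
        middle-private⇒∼ s∼t t∼r s≢r ws wt (deficient≢single dw st) w′r w′t (deficient≢single dw′ st)

      K : Fin n → Set
      K v = Single v × (x ≡ v ⊎ x ∼ v)

      K? : Decidable K
      K? v = Single? v ×-dec ((x ≟ᶠ v) ⊎-dec (x ∼? v))

      K-clique : ∀ {v w} → K v → K w → v ≢ w → v ∼ w
      K-clique (_  , inj₁ refl) (_  , inj₁ refl) v≢w = contradiction refl v≢w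
      K-clique (_  , inj₁ refl) (_  , inj₂ xw)   _   = xw
      K-clique (_  , inj₂ xv)   (_  , inj₁ refl) _   = ∼-sym xv
      K-clique (sv , inj₂ xv)   (sw , inj₂ xw)   v≢w = ∼-trans-single sv sx sw (∼-sym xv) xw v≢w

      -- By transitivity `K` is a whole connected component of the subgraph induced on the
      -- singletons.
      K-closed : ∀ {v w} → K v → Single w → v ≡ w ⊎ v ∼ w → K w
      K-closed kv             sw (inj₁ refl) = kv
      K-closed (_ , inj₁ refl) sw (inj₂ xw)   = sw , inj₂ xw
      K-closed {w = w} (sv , inj₂ xv) sw (inj₂ vw) with x ≟ᶠ w
      ... | yes x≡w = sw , inj₁ x≡w
      ... | no x≢w  = sw , inj₂ (∼-trans-single sx sv sw xv vw x≢w)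

      -- Here `u` is private to `z` against `z′`, and `priv` yields `v` private to `z′` against `z`.
      -- So `private-neighbour` puts `w` in the closed neighbourhood of `z`, and `K-closed` puts it
      -- in `K`.
      K-neighbours : ∀ {u z z′ w} → Deficient u → K z → K z′ → z ∼ z′ → u ∼ z → u ≁ z′ →
        u ∼ w → Single w → K w
      K-neighbours du kz@(sz , _) (sz′ , _) zz′ uz uz′ uw sw with priv sz′ sz (∼-sym zz′)
      ... | v , dv , vz′ , vz = K-closed kz sw
        (private-neighbour zz′ uz uz′ vz′ vz (deficient≢single du sz′) (deficient≢single dv sz) uw)

      -- Kept generic in `s` so that the colours {1} and {2} share one argument.
      module ColourClass (s : Sub12) (s-single : single s ≡ true)
        (neighbour : ∀ {u} → Deficient u → ∃ λ v → u ∼ v × f v ≡ s) where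

        D : Fin n → Set
        D v = K v × f v ≡ s

        D? : Decidable D
        D? v = K? v ×-dec (f v ≟ˢ s)

        D-neighbour : ∀ {u z z′} → Deficient u → K z → K z′ → z ∼ z′ → u ∼ z → u ≁ z′ →
          ∃ λ d → u ∼ d × D d
        D-neighbour du kz kz′ zz′ uz uz′ with neighbour du
        ... | d , ud , fd =
          d , ud , K-neighbours du kz kz′ zz′ uz uz′ ud (trans (cong single fd) s-single) , fd

        -- A private neighbour of `x` against `y` separates two members of `K`, so its neighbour of
        -- colour `s` lies in `K`.
        ∃D : ∃ D
        ∃D with priv sx sy xy
        ... | u , du , ux , uy with D-neighbour du (sx , inj₁ refl) (sy , inj₂ xy) xy ux uy
        ...   | d , _ , dd = d , dd

        K-dom : ∀ v → K v → ¬ D v → ∃ λ d → v ∼ d × D d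
        K-dom v kv ¬dv with ∃D
        ... | d , dd = d , K-clique kv (proj₁ dd) (λ { refl → ¬dv dd }) , dd

        -- Any fixed `d` in `D` is either adjacent to `u` itself, or `u` separates `z` from `d` and
        -- `D-neighbour` applies to this edge of the clique.
        deficient-dom : ∀ u z → Deficient u → ¬ D u → u ∼ z → K z → ∃ λ d → u ∼ d × D d
        deficient-dom u z du _ uz kz with ∃D
        ... | d , dd with ∼-or-≁ u d
        ...   | inj₁ ud = d , ud , dd
        ...   | inj₂ ud =
          D-neighbour du kz (proj₁ dd) (K-clique kz (proj₁ dd) (λ { refl → ≁⇒¬∼ ud uz })) uz ud

        improve : # D? + # D? ≤ # K? → Improvement
        improve 2D≤K = Exchange.improvement D? K? (λ _ → proj₁) K-dom deficient-dom 2D≤K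
          (x , sx , inj₁ refl)

      open ColourClass (true , false) refl neighbour₁ using () renaming (D? to D₁?; improve to improve₁)
      open ColourClass (false , true) refl neighbour₂ using () renaming (D? to D₂?; improve to improve₂)

      D₁+D₂≤K : # D₁? + # D₂? ≤ # K?
      D₁+D₂≤K = #-disjoint-≤ D₁? D₂? K? (λ _ → proj₁) (λ _ → proj₁)
        (λ { _ (_ , f≡1) (_ , f≡2) → case trans (sym f≡1) f≡2 of λ () })

      improve-clique : Improvement
      improve-clique with ≤-total (# D₁?) (# D₂?)
      ... | inj₁ 1≤2 = improve₁ (≤-trans (+-monoʳ-≤ (# D₁?) 1≤2) D₁+D₂≤K)
      ... | inj₂ 2≤1 = improve₂ (≤-trans (+-monoˡ-≤ (# D₂?) 2≤1) D₁+D₂≤K)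

    improve : ∃ Deficient → Improvement
    improve (u , du) with any? (λ x → any? λ y →
      Single? x ×-dec Single? y ×-dec (x ∼? y) ×-dec ¬? (PrivateNeighbour? x y))
    ... | yes (x , y , sx , sy , xy , nested) = improve-nested sx sy xy nested
    ... | no no-nested with any? (λ x → any? λ y → Single? x ×-dec Single? y ×-dec (x ∼? y))
    ...   | yes (x , y , sx , sy , xy) = Clique.improve-clique
      (λ {x} {y} sx sy xy → decidable-stable (PrivateNeighbour? x y)
        λ nested → no-nested (x , y , sx , sy , xy , nested))
      sx sy xy
    ...   | no no-edge = improve-independent du
      λ {x} {y} sx sy → Bool.¬-not λ xy → no-edge (x , y , sx , sy , xy)

  -- From 2-rainbow to Roman domination

  card₃ : Sub12 → Fin 3
  card₃ (true  , true)  = 2F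
  card₃ (true  , false) = 1F
  card₃ (false , true)  = 1F
  card₃ (false , false) = 0F

  toℕ-card₃ : ∀ s → toℕ (card₃ s) ≡ card s
  toℕ-card₃ (true  , true)  = refl
  toℕ-card₃ (true  , false) = refl
  toℕ-card₃ (false , true)  = refl
  toℕ-card₃ (false , false) = refl

  card₃≡0 : ∀ s → toℕ (card₃ s) ≡ 0 → s ≡ (false , false)
  card₃≡0 (true  , true)  ()
  card₃≡0 (true  , false) ()
  card₃≡0 (false , true)  ()
  card₃≡0 (false , false) _ = refl

  2RDF⇒RDF : ∀ f → Is2RDF (adj G) f → ∃ λ g → IsRDF (adj G) g × weightR g ≤ weight2R f
  2RDF⇒RDF f f-dom = go f f-dom (<-wellFounded (singles f))
    where
    go : ∀ f → Is2RDF (adj G) f → Acc _<ⁿ_ (singles f) →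
      ∃ λ g → IsRDF (adj G) g × weightR g ≤ weight2R f
    go f f-dom (acc rec) with any? (Recolour.Deficient? f f-dom)
    ... | yes deficient with Recolour.improve f f-dom deficient
    ...   | f′ , f′-dom , weight≤ , singles< with go f′ f′-dom (rec singles<)
    ...     | g , g-dom , g≤f′ = g , g-dom , ≤-trans g≤f′ weight≤
    go f f-dom (acc rec) | no none =
      card₃ ∘ f , dom , ≤-reflexive (Σv-cong (toℕ-card₃ ∘ f))
      where
      dom : IsRDF (adj G) (card₃ ∘ f)
      dom u gu≡0 with Recolour.fullNeighbour? f f-dom u
      ... | yes (c , uc , fc) = c , uc , cong (toℕ ∘ card₃) fc
      ... | no no-full = contradiction (u , card₃≡0 (f u) gu≡0 , no-full) none

-- From Roman to 2-rainbow domination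

fromFin3 : Fin 3 → Sub12
fromFin3 0F = false , false
fromFin3 1F = true  , false
fromFin3 2F = true  , true

RDF⇒2RDF : ∀ {n} (E : Adj n) g → IsRDF E g → ∃ λ f → Is2RDF E f × weight2R f ≡ weightR g
RDF⇒2RDF E g g-dom = fromFin3 ∘ g , dom , Σv-cong (card-fromFin3 ∘ g)
  where
  card-fromFin3 : ∀ i → card (fromFin3 i) ≡ toℕ i
  card-fromFin3 0F = refl
  card-fromFin3 1F = refl
  card-fromFin3 2F = refl
  empty⇒0 : ∀ i → fromFin3 i ≡ (false , false) → toℕ i ≡ 0
  empty⇒0 0F _ = refl
  empty⇒0 1F ()
  empty⇒0 2F ()
  2⇒full : ∀ i → toℕ i ≡ 2 → fromFin3 i ≡ (true , true)
  2⇒full 0F ()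
  2⇒full 1F ()
  2⇒full 2F _ = refl
  dom : Is2RDF E (fromFin3 ∘ g)
  dom u fu with g-dom u (empty⇒0 (g u) fu)
  ... | v , uv , gv = (v , uv , cong proj₁ (2⇒full (g v) gv)) , (v , uv , cong proj₂ (2⇒full (g v) gv))

free⇒γr2≡γR : ∀ {n} (G : Graph n) → P5C5C4-free G →
  ∀ a b → Isγr2 (adj G) a → IsγR (adj G) b → a ≡ b
free⇒γr2≡γR G free a b ((f , f-dom , refl) , a-min) ((g , g-dom , refl) , b-min)
  with Free.2RDF⇒RDF G free f f-dom | RDF⇒2RDF (adj G) g g-dom
... | g′ , g′-dom , g′≤f | f′ , f′-dom , f′≡g =
  ≤-antisym (≤-trans (a-min f′ f′-dom) (≤-reflexive f′≡g)) (≤-trans (b-min g′ g′-dom) g′≤f)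

-- The domination numbers of P₅, C₅ and C₄

allSub12? : ∀ {P : Sub12 → Set} → Decidable P → Dec (∀ s → P s)
allSub12? {P} P? = map′ to (λ p → p _ , p _ , p _ , p _)
  (P? (true , true) ×-dec P? (true , false) ×-dec P? (false , true) ×-dec P? (false , false))
  where
  to : P (true , true) × P (true , false) × P (false , true) × P (false , false) → ∀ s → P s
  to (p , _ , _ , _) (true  , true)  = p
  to (_ , p , _ , _) (true  , false) = p
  to (_ , _ , p , _) (false , true)  = p
  to (_ , _ , _ , p) (false , false) = p

-- Colourings of a small graph are enumerated as vectors, so that both minima are decided by
-- evaluation.
allVec? : ∀ {A : Set} → (∀ {P : A → Set} → Decidable P → Dec (∀ x → P x)) →
  ∀ k {P : Vec A k → Set} → Decidable P → Dec (∀ xs → P xs)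
allVec? all zero    P? = map′ (λ { p [] → p }) (λ p → p []) (P? [])
allVec? all (suc k) P? = map′ (λ { p (x ∷ xs) → p x xs }) (λ p x xs → p (x ∷ xs))
  (all λ x → allVec? all k λ xs → P? (x ∷ xs))

Is2RDF? : ∀ {n} (E : Adj n) f → Dec (Is2RDF E f)
Is2RDF? E f = all? λ u → (f u ≟ˢ (false , false)) →-dec
  (any? λ v → (E u v Bool.≟ true) ×-dec (proj₁ (f v) Bool.≟ true)) ×-dec
  (any? λ v → (E u v Bool.≟ true) ×-dec (proj₂ (f v) Bool.≟ true))

IsRDF? : ∀ {n} (E : Adj n) g → Dec (IsRDF E g)
IsRDF? E g = all? λ u → (toℕ (g u) ≟ⁿ 0) →-dec
  (any? λ v → (E u v Bool.≟ true) ×-dec (toℕ (g v) ≟ⁿ 2))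

-- Pointwise equality replaces function extensionality: an embedding matches adjacency only
-- pointwise, as does a function with the table of its values.
Is2RDF-resp : ∀ {n} {E E′ : Adj n} {f f′} →
  (∀ u v → E u v ≡ E′ u v) → f ≗ f′ → Is2RDF E f → Is2RDF E′ f′
Is2RDF-resp E≗E′ f≗f′ f-dom u f′u with f-dom u (trans (f≗f′ u) f′u)
... | (a , ua , 1∈fa) , (b , ub , 2∈fb) =
  (a , trans (sym (E≗E′ u a)) ua , trans (cong proj₁ (sym (f≗f′ a))) 1∈fa) ,
  (b , trans (sym (E≗E′ u b)) ub , trans (cong proj₂ (sym (f≗f′ b))) 2∈fb)

IsRDF-resp : ∀ {n} {E E′ : Adj n} {g g′} →
  (∀ u v → E u v ≡ E′ u v) → g ≗ g′ → IsRDF E g → IsRDF E′ g′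
IsRDF-resp E≗E′ g≗g′ g-dom u g′u with g-dom u (trans (cong toℕ (g≗g′ u)) g′u)
... | v , uv , gv = v , trans (sym (E≗E′ u v)) uv , trans (cong toℕ (sym (g≗g′ v))) gv

module _ {k} (E : Adj k) where

  γr2-certificate : Vec Sub12 k → ℕ → Set
  γr2-certificate xs c = (Is2RDF E (lookup xs) × weight2R (lookup xs) ≡ c) ×
    (∀ ys → Is2RDF E (lookup ys) → c ≤ weight2R (lookup ys))

  γr2-certificate? : ∀ xs c → Dec (γr2-certificate xs c)
  γr2-certificate? xs c = (Is2RDF? E (lookup xs) ×-dec (weight2R (lookup xs) ≟ⁿ c)) ×-dec
    (allVec? allSub12? k λ ys → Is2RDF? E (lookup ys) →-dec (c ≤? weight2R (lookup ys)))

  γR-certificate : Vec (Fin 3) k → ℕ → Set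
  γR-certificate xs c = (IsRDF E (lookup xs) × weightR (lookup xs) ≡ c) ×
    (∀ ys → IsRDF E (lookup ys) → c ≤ weightR (lookup ys))

  γR-certificate? : ∀ xs c → Dec (γR-certificate xs c)
  γR-certificate? xs c = (IsRDF? E (lookup xs) ×-dec (weightR (lookup xs) ≟ⁿ c)) ×-dec
    (allVec? all? k λ ys → IsRDF? E (lookup ys) →-dec (c ≤? weightR (lookup ys)))

  γr2-transfer : ∀ {E′} → (∀ u v → E u v ≡ E′ u v) →
    ∀ xs c → γr2-certificate xs c → Isγr2 E′ c
  γr2-transfer E≗E′ xs c ((dom , weight) , bound) =
    (lookup xs , Is2RDF-resp E≗E′ (λ _ → refl) dom , weight) ,
    λ f f-dom → ≤-trans
      (bound (tabulateᵛ f)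
        (Is2RDF-resp (λ u v → sym (E≗E′ u v)) (λ v → sym (lookup∘tabulate f v)) f-dom))
      (≤-reflexive (Σv-cong (λ v → cong card (lookup∘tabulate f v))))

  γR-transfer : ∀ {E′} → (∀ u v → E u v ≡ E′ u v) →
    ∀ xs c → γR-certificate xs c → IsγR E′ c
  γR-transfer E≗E′ xs c ((dom , weight) , bound) =
    (lookup xs , IsRDF-resp E≗E′ (λ _ → refl) dom , weight) ,
    λ g g-dom → ≤-trans
      (bound (tabulateᵛ g)
        (IsRDF-resp (λ u v → sym (E≗E′ u v)) (λ v → sym (lookup∘tabulate g v)) g-dom))
      (≤-reflexive (Σv-cong (λ v → cong toℕ (lookup∘tabulate g v))))

  -- The embedding itself serves as `ι`, and `match` carries both minima over to the induced
  -- subgraph.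
  certificates⇒excluded : ∀ xs a ys b → γr2-certificate xs a → γR-certificate ys b → a ≢ b →
    ∀ {n} (G : Graph n) → AllInducedEqual G → ¬ ContainsInduced E G
  certificates⇒excluded xs a ys b r2 R a≢b G equal (φ , φ-inj , match) =
    a≢b (equal k φ φ-inj a b (γr2-transfer match xs a r2) (γR-transfer match ys b R))

pattern ∅   = false , false
pattern ❴1❵ = true , false
pattern ❴2❵ = false , true

-- Roman weight 3 is too little for `P5` and `C5`: a vertex of value 2 covers at most three vertices
-- and one of value 1 only itself, at most four of five in all. In the rainbow function each empty
-- vertex lies between a {1} and a {2}.
P5-excluded : ∀ {n} (G : Graph n) → AllInducedEqual G → ¬ ContainsInduced P5 G
P5-excluded = certificates⇒excluded P5 xs 3 ys 4
  (from-yes (γr2-certificate? P5 xs 3)) (from-yes (γR-certificate? P5 ys 4)) λ ()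
  where
  xs = ❴1❵ ∷ ∅ ∷ ❴2❵ ∷ ∅ ∷ ❴1❵ ∷ []
  ys = 0F ∷ 2F ∷ 0F ∷ 1F ∷ 1F ∷ []

C5-excluded : ∀ {n} (G : Graph n) → AllInducedEqual G → ¬ ContainsInduced C5 G
C5-excluded = certificates⇒excluded C5 xs 3 ys 4
  (from-yes (γr2-certificate? C5 xs 3)) (from-yes (γR-certificate? C5 ys 4)) λ ()
  where
  xs = ❴1❵ ∷ ❴1❵ ∷ ∅ ∷ ❴2❵ ∷ ∅ ∷ []
  ys = 2F ∷ 0F ∷ 1F ∷ 1F ∷ 0F ∷ []

-- Roman weight 2 covers at most three of the four vertices, while {1} and {2} on opposite vertices
-- dominate both others.
C4-excluded : ∀ {n} (G : Graph n) → AllInducedEqual G → ¬ ContainsInduced C4 G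
C4-excluded = certificates⇒excluded C4 xs 2 ys 3
  (from-yes (γr2-certificate? C4 xs 2)) (from-yes (γR-certificate? C4 ys 3)) λ ()
  where
  xs = ❴1❵ ∷ ∅ ∷ ❴2❵ ∷ ∅ ∷ []
  ys = 2F ∷ 0F ∷ 1F ∷ 0F ∷ []

-- The equivalence

theorem4 : ∀ (n : ℕ) (G : Graph n) → AllInducedEqual G ⇔ P5C5C4-free G
theorem4 n G = mk⇔
  (λ equal → P5-excluded G equal , C5-excluded G equal , C4-excluded G equal)
  (λ free m ι ι-inj → free⇒γr2≡γR (inducedGraph G ι)
    (induced-free G ι (λ {x} {y} → ι-inj {x} {y}) free))
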